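{- Let $(X,\mathbf{d})$ be a finite metric space of doubling dimension $\operatorname{ddim}$ with $|X|\ge 2$, and let $T$ be an arbitrary minimum spanning tree of $X$. Then for every vertex $p\in X$, $$\deg_T(p)\le 2^{O(\operatorname{ddim})}\cdot\log\Delta,$$ where $\Delta=\dfrac{\max_{q\in X\setminus\{p\}}\mathbf{d}(p,q)}{\min_{q\in X\setminus\{p\}}\mathbf{d}(p,q)}$ is the aspect ratio of the distances from $p$.
   Context: The doubling dimension of a metric space $(X,\mathbf{d})$ is the smallest $t\ge 0$ such that every metric ball $B(x,r)=\{y\in X:\mathbf{d}(x,y)\le r\}$ can be covered by at most $2^t$ balls of half the radius. A minimum spanning tree of $X$ is a minimum-weight spanning tree of the complete graph on $X$ with edge weights $\mathbf{d}(x,y)$; $\deg_T(p)$ is the degree of $p$ in $T$. The constant hidden in $O(\cdot)$ is absolute.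
   Formalization: The factor log Δ is read as max(1, log₂ Δ), since the bound fails as written when Δ is 1 or near 1 (for |X| = 2 the degree is 1 while log Δ = 0); for Δ ≥ 2 the two agree. -}

module Defs where

open import Level using (Level; suc; _⊔_)
open import Algebra.Apartness.Bundles using (HeytingCommutativeRing; HeytingField)
open import Algebra.Bundles using (CommutativeRing; Semiring)
import Algebra.Definitions.RawSemiring as RawSemiringDefs
open import Data.Bool.Base using (if_then_else_)
open import Data.Fin.Base using (Fin)
open import Data.Fin.Properties using (_<?_)
open import Data.Fin.Subset using (Subset; _∈_; ∣_∣)
open import Data.Fin.Subset.Properties using (_∈?_)
open import Data.List.Base using (List; []; _∷_; _++_; length)
open import Data.List.Relation.Unary.Any using (Any)
open import Data.List.Relation.Unary.Linked using (Linked)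
open import Data.List.Relation.Unary.Unique.Propositional using (Unique)
open import Data.Nat.Base as ℕ using (ℕ)
open import Data.Product.Base using (Σ-syntax; ∃-syntax; _×_)
open import Data.Sum.Base using (_⊎_)
open import Function.Metric.Structures using (IsGeneralMetric)
open import Relation.Binary.Core using (Rel)
open import Relation.Binary.Construct.Closure.ReflexiveTransitive using (Star)
open import Relation.Binary.Lattice.Definitions using (Supremum)
open import Relation.Binary.PropositionalEquality.Core using (_≡_; _≢_)
open import Relation.Binary.Structures using (IsStrictPartialOrder)
open import Relation.Nullary.Decidable.Core using (does; _×-dec_)
open import Relation.Nullary.Negation.Core using (¬_)

-- The real numbers, as a Cauchy-complete Archimedean ordered field.
-- Classically this determines ℝ up to unique isomorphism.  The order is not
-- required to be decidable, so that constructive reals qualify as well.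

record RealNumbers (c ℓ₁ ℓ₂ : Level) : Set (suc (c ⊔ ℓ₁ ⊔ ℓ₂)) where
  field
    heytingField : HeytingField c ℓ₁ ℓ₂

  open HeytingField heytingField public
    using (Carrier; _≈_; _#_; _+_; _*_; -_; _-_; 0#; 1#; heytingCommutativeRing)

  open HeytingCommutativeRing heytingCommutativeRing public using (commutativeRing)

  open RawSemiringDefs (Semiring.rawSemiring (CommutativeRing.semiring commutativeRing)) public using (_^_; sum) renaming (_×_ to _·_)

  infix 4 _<_ _≤_ _⟶_

  field
    _<_                  : Rel Carrier ℓ₂
    isStrictPartialOrder : IsStrictPartialOrder _≈_ _<_
    #⇒<⊎>                : ∀ {x y} → x # y → x < y ⊎ y < x
    <⇒#                  : ∀ {x y} → x < y → x # y
    +-monoˡ-<            : ∀ {x y} z → x < y → x + z < y + z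
    *-pos                : ∀ {x y} → 0# < x → 0# < y → 0# < x * y

  _≤_ : Rel Carrier ℓ₂
  x ≤ y = ¬ (y < x)

  fromℕ : ℕ → Carrier
  fromℕ n = n · 1#

  IsCauchy : (ℕ → Carrier) → Set (c ⊔ ℓ₂)
  IsCauchy s = ∀ ε → 0# < ε →
    ∃[ N ] (∀ i j → N ℕ.≤ i → N ℕ.≤ j → s i - s j < ε)

  _⟶_ : (ℕ → Carrier) → Carrier → Set (c ⊔ ℓ₂)
  s ⟶ l = ∀ ε → 0# < ε →
    ∃[ N ] (∀ i → N ℕ.≤ i → (s i - l < ε) × (l - s i < ε))

  field
    max          : Carrier → Carrier → Carrier
    max-supremum : Supremum _≤_ max
    archimedean  : ∀ x → ∃[ n ] x < fromℕ n
    complete     : ∀ s → IsCauchy s → ∃[ l ] s ⟶ l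

  -- y = 2 ^ t for real t: y is the positive number comparing with the powers
  -- 2 ^ ((a - b) / k) as t compares with the exponents (a - b) / k.  (The case
  -- k = 0 holds trivially.)  Read from right to left, t = log₂ y.

  infix 4 _≈2^_

  record _≈2^_ (y t : Carrier) : Set (c ⊔ ℓ₂) where
    field
      positive : 0# < y
      lower    : ∀ a b k → fromℕ a ≤ fromℕ b + fromℕ k * t →
                 fromℕ 2 ^ a ≤ fromℕ 2 ^ b * y ^ k
      upper    : ∀ a b k → fromℕ b + fromℕ k * t ≤ fromℕ a →
                 fromℕ 2 ^ b * y ^ k ≤ fromℕ 2 ^ a

  IsLog₂ : Carrier → Carrier → Set (c ⊔ ℓ₂)
  IsLog₂ y t = y ≈2^ t

record Graph (n : ℕ) : Set where
  field
    nbrs : Fin n → Subset n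

  Adj : Rel (Fin n) _
  Adj u v = v ∈ nbrs u

  field
    symmetric   : ∀ {u v} → Adj u v → Adj v u
    irreflexive : ∀ {u} → ¬ Adj u u

  degree : Fin n → ℕ
  degree u = ∣ nbrs u ∣

  Connected : Set
  Connected = ∀ u v → Star Adj u v

  IsCycle : Fin n → List (Fin n) → Set
  IsCycle v vs = 2 ℕ.≤ length vs × Unique (v ∷ vs) × Linked Adj (v ∷ vs ++ v ∷ [])

  IsTree : Set
  IsTree = Connected × (∀ v vs → ¬ IsCycle v vs)

open Graph using (nbrs; IsTree)

module _ {c ℓ₁ ℓ₂} (ℝ : RealNumbers c ℓ₁ ℓ₂) where
  open RealNumbers ℝ

  record FiniteMetricSpace (n : ℕ) : Set (c ⊔ ℓ₁ ⊔ ℓ₂) where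
    field
      d        : Fin n → Fin n → Carrier
      isMetric : IsGeneralMetric _≡_ _≈_ _≤_ 0# _+_ d

    Ball : Fin n → Carrier → Fin n → Set ℓ₂
    Ball x r y = d x y ≤ r

    -- The radius is written as s + s, so that s is half of it.
    BallsCoveredBy2^ : Carrier → Set (c ⊔ ℓ₂)
    BallsCoveredBy2^ t = ∃[ N ] (N ≈2^ t) × (∀ x s →
      Σ[ centres ∈ List (Fin n) ]
        (fromℕ (length centres) ≤ N) ×
        (∀ y → Ball x (s + s) y → Any (λ z → Ball z s y) centres))

    IsDoublingDimension : Carrier → Set (c ⊔ ℓ₂)
    IsDoublingDimension t =
      (0# ≤ t) × BallsCoveredBy2^ t ×
      (∀ t′ → 0# ≤ t′ → BallsCoveredBy2^ t′ → t ≤ t′)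

    weight : Graph n → Carrier
    weight G = sum λ u → sum λ v →
      if does (u <? v ×-dec v ∈? nbrs G u) then d u v else 0#

    IsMinimumSpanningTree : Graph n → Set ℓ₂
    IsMinimumSpanningTree T = IsTree T × (∀ T′ → IsTree T′ → weight T ≤ weight T′)

    IsMaxDistance : Fin n → Carrier → Set (ℓ₁ ⊔ ℓ₂)
    IsMaxDistance p M = (∀ q → q ≢ p → d p q ≤ M) × ∃[ q ] (q ≢ p) × (d p q ≈ M)

    IsMinDistance : Fin n → Carrier → Set (ℓ₁ ⊔ ℓ₂)
    IsMinDistance p m = (∀ q → q ≢ p → m ≤ d p q) × ∃[ q ] (q ≢ p) × (d p q ≈ m)

    -- Δ = M / m; here m is nonzero, being the distance from p to another point.
    IsAspectRatio : Fin n → Carrier → Set (c ⊔ ℓ₁ ⊔ ℓ₂)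
    IsAspectRatio p Δ =
      ∃[ M ] ∃[ m ] IsMaxDistance p M × IsMinDistance p m × (Δ * m ≈ M)

{-# OPTIONS --safe #-}
module Submission where

-- Two neighbours q, r of p in a minimum spanning tree satisfy
-- d(p,q) ≤ d(q,r), since otherwise exchanging the edge pq for qr gives a
-- lighter tree.  Hence the neighbours at distance between ρ and 2ρ from p are
-- at distance at least ρ from each other.  Halving the radius three times
-- covers the ball of radius 2ρ about p by K³ balls of radius ρ/4, each
-- containing at most one of these neighbours, where K = 2 ^ ⌈ddim⌉ bounds the
-- number of balls for one halving.  About log Δ dyadic values of ρ reach every
-- neighbour.  The rounding of ddim and log Δ is absorbed into the exponent:
-- the ball about p reaching only its nearest point is not covered by a single
-- ball of half the radius, so 1 ≤ 2 ddim.
--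
-- The order of ℝ is not decidable, but the claim is a negation, so finitely
-- many comparisons may be decided under a double negation.

open import Defs
open import Algebra.Apartness.Bundles using (HeytingField)
import Algebra.Apartness.Properties.HeytingCommutativeRing as ApartnessProperties
open import Algebra.Bundles using (CommutativeRing)
import Algebra.Properties.CommutativeMonoid.Sum as Sum
import Algebra.Properties.Ring as RingProperties
import Algebra.Properties.Semiring.Mult as MultProperties
open import Data.Bool.Base using (true; if_then_else_)
open import Data.Fin.Base as Fin using (Fin; zero; suc)
open import Data.Fin.Properties using (_≟_; _<?_; suc-injective; injective⇒≤; <-cmp)
import Data.Fin.Properties as Fin
open import Data.Fin.Subset using (Subset; _∈_; ∣_∣; inside; outside)
open import Data.Fin.Subset.Properties using (_∈?_)
open import Data.List.Base as List using (List; []; _∷_; _++_; length; concatMap)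
import Data.List.Membership.DecPropositional as DecMembership
open import Data.List.Membership.Propositional using () renaming (_∈_ to _∈ˡ_)
open import Data.List.Properties using (length-map; length-++)
open import Data.List.Relation.Unary.All using (All; []; _∷_)
open import Data.List.Relation.Unary.All.Properties using (¬Any⇒All¬)
open import Data.List.Relation.Unary.AllPairs using ([]; _∷_)
open import Data.List.Relation.Unary.Any as Any using (Any; here; there; index)
import Data.List.Relation.Unary.Any.Properties as Any
open import Data.List.Relation.Unary.Linked using (Linked; [-]; _∷_)
open import Data.List.Relation.Unary.Unique.Propositional using (Unique)
open import Data.Nat.Base as ℕ using (ℕ; z≤n; s≤s)
import Data.Nat.Properties as ℕ
open import Data.Product.Base using (∃-syntax; Σ-syntax; _×_; _,_; proj₁; proj₂)
open import Data.Sum.Base using (_⊎_; inj₁; inj₂; [_,_]; map₁)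
open import Data.Vec.Base using ([]; _∷_; tabulate; here; there)
open import Data.Vec.Properties using (lookup⇒[]=; []=⇒lookup; lookup∘tabulate)
open import Function.Base using (_∘_; case_of_)
open import Function.Metric.Structures using (IsGeneralMetric)
open import Level using (0ℓ; _⊔_)
open import Relation.Binary.Bundles using (Poset)
open import Relation.Binary.Construct.Closure.ReflexiveTransitive using (Star; ε; _◅_; _◅◅_; reverse; map)
open import Relation.Binary.Core using (Rel; _⇒_)
open import Relation.Binary.Definitions using (Decidable; Symmetric; tri<; tri≈; tri>)
open import Relation.Binary.PropositionalEquality.Core using (_≡_; _≢_; refl; sym; trans; cong; subst; ≢-sym)
import Relation.Binary.Reasoning.PartialOrder as PartialOrderReasoning
open import Relation.Binary.Structures using (IsStrictPartialOrder)
open import Relation.Nullary.Decidable using (dec-true)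
open import Relation.Nullary.Decidable.Core using (Dec; yes; no; does; _×-dec_; _⊎-dec_; ¬?; decidable-stable)
open import Relation.Nullary.Negation.Core using (¬_; contradiction)

-- Ordered fields

module OrderedField {c ℓ₁ ℓ₂} (ℝ : RealNumbers c ℓ₁ ℓ₂) where
  open RealNumbers ℝ
  open CommutativeRing commutativeRing public
    using (+-cong; +-congˡ; +-congʳ; +-assoc; +-comm; +-identityˡ; +-identityʳ;
           -‿inverseʳ; -‿cong; *-assoc; *-congˡ; *-congʳ; *-comm; *-identityˡ; *-identityʳ; distribˡ;
           zeroˡ; semiring; ring; +-commutativeMonoid; isEquivalence)
    renaming (refl to ≈-refl; sym to ≈-sym; trans to ≈-trans)
  open HeytingField heytingField using (tight; #-sym; #-cotrans; #⇒invertible)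
  open ApartnessProperties heytingCommutativeRing using (1#0; x-0≈x)
  open RingProperties ring using (-‿distribˡ-*; -‿involutive)
  open MultProperties semiring public using (×-homo-+; ×-assoc-*; ×-congʳ; ×1-homo-*)
  open IsStrictPartialOrder isStrictPartialOrder public
    using (<-respˡ-≈; <-respʳ-≈) renaming (irrefl to <-irrefl; trans to <-trans; asym to <-asym)

  private variable
    w x y z : Carrier

  <⇒≤ : x < y → x ≤ y
  <⇒≤ = <-asym

  -- Cotransitivity of `#` separates z from x or from y, and y ≤ z rules out the wrong order in
  -- either case.
  <-≤-trans : x < y → y ≤ z → x < z
  <-≤-trans {z = z} x<y y≤z with #-cotrans (<⇒# x<y) z
  ... | inj₂ z#y = [ (λ z<y → contradiction z<y y≤z) , <-trans x<y ] (#⇒<⊎> z#y)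
  ... | inj₁ x#z = [ (λ x<z → x<z) , (λ z<x → contradiction (<-trans z<x x<y) y≤z) ] (#⇒<⊎> x#z)

  ≤-reflexive : x ≈ y → x ≤ y
  ≤-reflexive x≈y y<x = <-irrefl (≈-sym x≈y) y<x

  ≤-trans : x ≤ y → y ≤ z → x ≤ z
  ≤-trans x≤y y≤z z<x = y≤z (<-≤-trans z<x x≤y)

  ≤-antisym : x ≤ y → y ≤ x → x ≈ y
  ≤-antisym {x} {y} x≤y y≤x = proj₁ (tight x y) λ x#y → [ y≤x , x≤y ] (#⇒<⊎> x#y)

  ≤-poset : Poset c ℓ₁ ℓ₂
  ≤-poset = record
    { isPartialOrder = record
      { isPreorder = record { isEquivalence = isEquivalence ; reflexive = ≤-reflexive ; trans = ≤-trans }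
      ; antisym    = ≤-antisym
      }
    }

  module ≤-Reasoning = PartialOrderReasoning ≤-poset
  open ≤-Reasoning

  ≤-dichotomy : ∀ x y → ¬ ¬ (x ≤ y ⊎ y < x)
  ≤-dichotomy x y k = k (inj₁ (k ∘ inj₂))

  private
    x+z-z≈x : ∀ x z → x + z + - z ≈ x
    x+z-z≈x x z = ≈-trans (+-assoc x z (- z)) (≈-trans (+-congˡ (-‿inverseʳ z)) (+-identityʳ x))

    x-z+z≈x : ∀ x z → x + - z + z ≈ x
    x-z+z≈x x z = ≈-trans (+-assoc x (- z) z)
      (≈-trans (+-congˡ (≈-trans (+-comm (- z) z) (-‿inverseʳ z))) (+-identityʳ x))

  +-cancelʳ-< : ∀ z → x + z < y + z → x < y
  +-cancelʳ-< {x} {y} z lt = <-respˡ-≈ (x+z-z≈x x z) (<-respʳ-≈ (x+z-z≈x y z) (+-monoˡ-< (- z) lt))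

  +-monoʳ-< : ∀ z → x < y → z + x < z + y
  +-monoʳ-< {x} {y} z x<y = <-respˡ-≈ (+-comm x z) (<-respʳ-≈ (+-comm y z) (+-monoˡ-< z x<y))

  +-monoˡ-≤ : ∀ z → x ≤ y → x + z ≤ y + z
  +-monoˡ-≤ z x≤y = x≤y ∘ +-cancelʳ-< z

  +-monoʳ-≤ : ∀ z → x ≤ y → z + x ≤ z + y
  +-monoʳ-≤ {x} {y} z x≤y = begin
    z + x ≈⟨ +-comm z x ⟩
    x + z ≤⟨ +-monoˡ-≤ z x≤y ⟩
    y + z ≈⟨ +-comm y z ⟩
    z + y ∎

  +-mono-≤ : w ≤ x → y ≤ z → w + y ≤ x + z
  +-mono-≤ {x = x} {y} w≤x y≤z = ≤-trans (+-monoˡ-≤ y w≤x) (+-monoʳ-≤ x y≤z)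

  +-cancelˡ-≤ : ∀ z → z + x ≤ z + y → x ≤ y
  +-cancelˡ-≤ {x} {y} z z+x≤z+y y<x =
    z+x≤z+y (+-monoʳ-< z y<x)

  -- The conclusion is a negation, so both hypotheses may be split into equality and strict
  -- inequality. Equality in either makes the two products equal; `*-pos` settles the strict case.
  *-monoʳ-≤ : 0# ≤ z → x ≤ y → z * x ≤ z * y
  *-monoʳ-≤ {z} {x} {y} 0≤z x≤y zy<zx = ≤-dichotomy y x λ where
      (inj₁ y≤x) → <-irrefl (*-congˡ (≤-antisym y≤x x≤y)) zy<zx
      (inj₂ x<y) → ≤-dichotomy z 0# λ where
        (inj₁ z≤0) → <-irrefl (≈-trans (z*≈0 z≤0) (≈-sym (z*≈0 z≤0))) zy<zx
        (inj₂ 0<z) → <-asym zy<zx (zx<zy x<y 0<z)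
    where
    z*≈0 : ∀ {w} → z ≤ 0# → z * w ≈ 0#
    z*≈0 {w} z≤0 = ≈-trans (*-congʳ (≤-antisym z≤0 0≤z)) (zeroˡ w)
    zx<zy : x < y → 0# < z → z * x < z * y
    zx<zy x<y 0<z =
      <-respˡ-≈ (+-identityˡ (z * x))
        (<-respʳ-≈ (≈-trans (≈-sym (distribˡ z (y - x) x)) (*-congˡ (x-z+z≈x y x)))
          (+-monoˡ-< (z * x)
            (*-pos 0<z (<-respˡ-≈ (-‿inverseʳ x) (+-monoˡ-< (- x) x<y)))))

  *-monoˡ-≤ : 0# ≤ z → x ≤ y → x * z ≤ y * z
  *-monoˡ-≤ {z} {x} {y} 0≤z x≤y = begin
    x * z ≈⟨ *-comm x z ⟩
    z * x ≤⟨ *-monoʳ-≤ 0≤z x≤y ⟩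
    z * y ≈⟨ *-comm z y ⟩
    y * z ∎

  -- Since 1 is apart from 0, only 1 < 0 has to be excluded; it would make the square of -1, which
  -- is 1, positive.
  0<1 : 0# < 1#
  0<1 with #⇒<⊎> 1#0
  ... | inj₂ 0<1 = 0<1
  ... | inj₁ 1<0 = contradiction (<-respʳ-≈ -1*-1≈1 (*-pos 0<-1 0<-1)) (<-asym 1<0)
    where
    0<-1 : 0# < - 1#
    0<-1 = <-respˡ-≈ (-‿inverseʳ 1#) (<-respʳ-≈ (+-identityˡ (- 1#)) (+-monoˡ-< (- 1#) 1<0))
    -1*-1≈1 : - 1# * - 1# ≈ 1#
    -1*-1≈1 = ≈-trans (≈-sym (-‿distribˡ-* 1# (- 1#)))
      (≈-trans (-‿cong (*-identityˡ (- 1#))) (-‿involutive 1#))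

  x≤1+x : ∀ x → x ≤ 1# + x
  x≤1+x x = begin
    x      ≈⟨ +-identityˡ x ⟨
    0# + x ≤⟨ +-monoˡ-≤ x (<⇒≤ 0<1) ⟩
    1# + x ∎

  0≤fromℕ : ∀ n → 0# ≤ fromℕ n
  0≤fromℕ ℕ.zero    = ≤-reflexive ≈-refl
  0≤fromℕ (ℕ.suc n) = ≤-trans (0≤fromℕ n) (x≤1+x (fromℕ n))

  fromℕ-mono-≤ : ∀ {m n} → m ℕ.≤ n → fromℕ m ≤ fromℕ n
  fromℕ-mono-≤ {n = n} z≤n = 0≤fromℕ n
  fromℕ-mono-≤ (s≤s m≤n)   = +-monoʳ-≤ 1# (fromℕ-mono-≤ m≤n)

  fromℕ-mono-< : ∀ {m n} → m ℕ.< n → fromℕ m < fromℕ n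
  fromℕ-mono-< {m} {n} m<n = <-≤-trans m<1+m (fromℕ-mono-≤ m<n)
    where
    m<1+m : fromℕ m < fromℕ (ℕ.suc m)
    m<1+m = <-respˡ-≈ (+-identityˡ (fromℕ m)) (+-monoˡ-< (fromℕ m) 0<1)

  fromℕ-cancel-≤ : ∀ {m n} → fromℕ m ≤ fromℕ n → m ℕ.≤ n
  fromℕ-cancel-≤ m≤n = ℕ.≮⇒≥ λ n<m → m≤n (fromℕ-mono-< n<m)

  fromℕ-^ : ∀ m n → fromℕ (m ℕ.^ n) ≈ fromℕ m ^ n
  fromℕ-^ m ℕ.zero    = +-identityʳ 1#
  fromℕ-^ m (ℕ.suc n) = ≈-trans (×1-homo-* m (m ℕ.^ n)) (*-congˡ (fromℕ-^ m n))

  2·x≈x+x : ∀ x → 2 · x ≈ x + x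
  2·x≈x+x x = +-congˡ (+-identityʳ x)

  fromℕ*≈· : ∀ n x → fromℕ n * x ≈ n · x
  fromℕ*≈· n x = ≈-trans (×-assoc-* n 1# x) (×-congʳ n (*-identityˡ x))

  x+x≤x⇒x≤0 : x + x ≤ x → x ≤ 0#
  x+x≤x⇒x≤0 {x} x+x≤x = +-cancelˡ-≤ x (≤-trans x+x≤x (≤-reflexive (≈-sym (+-identityʳ x))))

  halving : ∀ x → ∃[ y ] x ≈ y + y
  -- The number 2 is positive, hence apart from 0 and invertible.
  halving x with #⇒invertible (#-sym (<⇒# (fromℕ-mono-< {0} {2} (s≤s z≤n))))
  ... | h , _ , 2*h≈1 = h * x , ≈-sym (begin-equality
    h * x + h * x          ≈⟨ 2·x≈x+x (h * x) ⟨
    2 · (h * x)            ≈⟨ fromℕ*≈· 2 (h * x) ⟨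
    fromℕ 2 * (h * x)      ≈⟨ *-assoc (fromℕ 2) h x ⟨
    fromℕ 2 * h * x        ≈⟨ *-congʳ (*-congʳ (x-0≈x (fromℕ 2))) ⟨
    (fromℕ 2 - 0#) * h * x ≈⟨ *-congʳ 2*h≈1 ⟩
    1# * x                 ≈⟨ *-identityˡ x ⟩
    x                      ∎)

  -- Start from an Archimedean bound and descend while x stays below the next smaller natural
  -- number. Each comparison is undecided, hence the double negation.
  ceiling : 0# ≤ x → ¬ ¬ (∃[ n ] x ≤ fromℕ n × fromℕ n ≤ 1# + x)
  ceiling {x} 0≤x = let n , x<n = archimedean x in below n (<⇒≤ x<n)
    where
    below : ∀ n → x ≤ fromℕ n → ¬ ¬ (∃[ n ] x ≤ fromℕ n × fromℕ n ≤ 1# + x)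
    below ℕ.zero    x≤0 k = k (0 , x≤0 , ≤-trans 0≤x (x≤1+x x))
    below (ℕ.suc n) x≤n k = ≤-dichotomy x (fromℕ n) λ where
      (inj₁ x≤n) → below n x≤n k
      (inj₂ n<x) → k (ℕ.suc n , x≤n , +-monoʳ-≤ 1# (<⇒≤ n<x))

-- Edge exchange in trees

private variable
  n : ℕ
  a b p q r u v w x y : Fin n
  R S : Rel (Fin n) 0ℓ

SameEdge : (a b u v : Fin n) → Set
SameEdge a b u v = (u ≡ a × v ≡ b) ⊎ (u ≡ b × v ≡ a)

sameEdge? : (a b u v : Fin n) → Dec (SameEdge a b u v)
sameEdge? a b u v = (u ≟ a ×-dec v ≟ b) ⊎-dec (u ≟ b ×-dec v ≟ a)

SameEdge-swap : SameEdge a b u v → SameEdge a b v u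
SameEdge-swap (inj₁ (u≡a , v≡b)) = inj₂ (v≡b , u≡a)
SameEdge-swap (inj₂ (u≡b , v≡a)) = inj₁ (v≡a , u≡b)

SameEdge-sym : SameEdge a b u v → SameEdge u v a b
SameEdge-sym (inj₁ (refl , refl)) = inj₁ (refl , refl)
SameEdge-sym (inj₂ (refl , refl)) = inj₂ (refl , refl)

-- Edges are changed on relations rather than on graphs, so that walks can be carried along
-- inclusions; decidability enters only when a graph is built.
Delete Insert : Rel (Fin n) 0ℓ → (a b : Fin n) → Rel (Fin n) 0ℓ
Delete R a b u v = R u v × ¬ SameEdge a b u v
Insert R a b u v = R u v ⊎ SameEdge a b u v

Exchange : Rel (Fin n) 0ℓ → (p q r : Fin n) → Rel (Fin n) 0ℓ
Exchange R p q r = Insert (Delete R p q) q r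

Delete-symmetric : Symmetric R → Symmetric (Delete R a b)
Delete-symmetric R-sym (r , ¬s) = R-sym r , ¬s ∘ SameEdge-swap

Insert-symmetric : Symmetric R → Symmetric (Insert R a b)
Insert-symmetric R-sym (inj₁ r) = inj₁ (R-sym r)
Insert-symmetric R-sym (inj₂ s) = inj₂ (SameEdge-swap s)

-- Acyclicity is handled in the form that every edge is a bridge, which an exchange preserves by
-- rerouting walks.
IsBridge : Rel (Fin n) 0ℓ → Rel (Fin n) 0ℓ
IsBridge R u v = ¬ Star (Delete R u v) u v

IsBridge-sym : Symmetric R → IsBridge R u v → IsBridge R v u
IsBridge-sym {R = R} {u} {v} R-sym bridge walk =
  bridge (map flip (reverse (Delete-symmetric {R = R} R-sym) walk))
  where
  flip : Delete R v u ⇒ Delete R u v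
  flip (r , ¬s) = r , ¬s ∘ SameEdge-sym ∘ SameEdge-swap ∘ SameEdge-sym

substitute : (∀ {x y} → R x y → Star S x y) → Star R u v → Star S u v
substitute f ε       = ε
substitute f (r ◅ w) = f r ◅◅ substitute f w

-- Cut the walk just before its first use of the new edge: it then stands at a or b.
prefix : Star (Insert R a b) u v → Star R u v ⊎ (Star R u a ⊎ Star R u b)
prefix ε                                = inj₁ ε
prefix (inj₂ (inj₁ (refl , refl)) ◅ _) = inj₂ (inj₁ ε)
prefix (inj₂ (inj₂ (refl , refl)) ◅ _) = inj₂ (inj₂ ε)
prefix (inj₁ r ◅ w) with prefix w
... | inj₁ w′        = inj₁ (r ◅ w′)
... | inj₂ (inj₁ w′) = inj₂ (inj₁ (r ◅ w′))
... | inj₂ (inj₂ w′) = inj₂ (inj₂ (r ◅ w′))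

module _ {R : Rel (Fin n) 0ℓ} (R-sym : Symmetric R) (R-irrefl : ∀ {u} → ¬ R u u)
         (pq : R p q) (pr : R p r) (q≢r : q ≢ r) where

  private
    ¬same-pr : ¬ SameEdge p q p r
    ¬same-pr (inj₁ (_ , refl)) = q≢r refl
    ¬same-pr (inj₂ (refl , _)) = R-irrefl pq

    ¬same-rp : ¬ SameEdge p q r p
    ¬same-rp = ¬same-pr ∘ SameEdge-swap

  Exchange-symmetric : Symmetric (Exchange R p q r)
  Exchange-symmetric = Insert-symmetric (Delete-symmetric R-sym)

  Exchange-irreflexive : ¬ Exchange R p q r u u
  Exchange-irreflexive (inj₁ (r , _))             = R-irrefl r
  Exchange-irreflexive (inj₂ (inj₁ (refl , q≡r))) = q≢r q≡r
  Exchange-irreflexive (inj₂ (inj₂ (refl , r≡q))) = q≢r (sym r≡q)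

  Exchange-connected : Star R u v → Star (Exchange R p q r) u v
  Exchange-connected = substitute step
    where
    step : R x y → Star (Exchange R p q r) x y
    step {x} {y} xy with sameEdge? p q x y
    ... | no ¬s                     = inj₁ (xy , ¬s) ◅ ε
    -- The lost edge pq is replaced by the walk p, r, q.
    ... | yes (inj₁ (refl , refl)) = inj₁ (pr , ¬same-pr) ◅ inj₂ (inj₂ (refl , refl)) ◅ ε
    ... | yes (inj₂ (refl , refl)) = inj₂ (inj₁ (refl , refl)) ◅ inj₁ (R-sym pr , ¬same-rp) ◅ ε

  module _ (bridges : ∀ {u v} → R u v → IsBridge R u v) where

    private
      -- Apart from the new edge only edges of R other than pq remain, so such a walk from r to q,
      -- preceded by the edge pr, would join p to q without pq.
      new-isBridge : IsBridge (Exchange R p q r) r q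
      new-isBridge walk = bridges pq ((pr , ¬same-pr) ◅ map old walk)
        where
        old : Delete (Exchange R p q r) r q ⇒ Delete R p q
        old (inj₁ xy , _)          = xy
        old (inj₂ (inj₁ s) , ¬new) = contradiction (inj₂ s) ¬new
        old (inj₂ (inj₂ s) , ¬new) = contradiction (inj₁ s) ¬new

      -- A walk from p to r avoiding the edge pr may use the new edge qr, but it
      -- must first reach q or r without it.
      pr-isBridge : IsBridge (Exchange R p q r) p r
      pr-isBridge walk with prefix (map assoc walk)
        where
        assoc : Delete (Exchange R p q r) p r ⇒ Insert (Delete (Delete R p q) p r) q r
        assoc (inj₁ xy , ¬pr) = inj₁ (xy , ¬pr)
        assoc (inj₂ s , _)    = inj₂ s
      ... | inj₁ w        = bridges pr (map (λ (xy , ¬pr) → proj₁ xy , ¬pr) w)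
      ... | inj₂ (inj₁ w) = bridges pq (map proj₁ w)
      ... | inj₂ (inj₂ w) = bridges pr (map (λ (xy , ¬pr) → proj₁ xy , ¬pr) w)

    Exchange-isBridge : Exchange R p q r u v → IsBridge (Exchange R p q r) u v
    Exchange-isBridge (inj₂ (inj₁ (refl , refl))) = IsBridge-sym Exchange-symmetric new-isBridge
    Exchange-isBridge (inj₂ (inj₂ (refl , refl))) = new-isBridge
    Exchange-isBridge {u} {v} (inj₁ (uv , ¬pq)) with sameEdge? p r u v
    ... | yes (inj₁ (refl , refl)) = pr-isBridge
    ... | yes (inj₂ (refl , refl)) = IsBridge-sym Exchange-symmetric pr-isBridge
    -- Here uv is neither pq nor pr, so each use of qr can be replaced by the walk q, p, r in R,
    -- which avoids uv.
    ... | no ¬pr                   = bridges uv ∘ substitute detour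
      where
      ¬qp : ¬ SameEdge u v q p
      ¬qp = ¬pq ∘ SameEdge-sym ∘ SameEdge-swap
      ¬rp : ¬ SameEdge u v r p
      ¬rp = ¬pr ∘ SameEdge-sym ∘ SameEdge-swap
      detour : Delete (Exchange R p q r) u v x y → Star (Delete R u v) x y
      detour (inj₁ (xy , _) , ¬uv) = (xy , ¬uv) ◅ ε
      detour (inj₂ (inj₁ (refl , refl)) , _) =
        (R-sym pq , ¬qp) ◅ (pr , ¬pr ∘ SameEdge-sym) ◅ ε
      detour (inj₂ (inj₂ (refl , refl)) , _) =
        (R-sym pr , ¬rp) ◅ (pq , ¬pq ∘ SameEdge-sym) ◅ ε

-- Cycles and bridges

-- The list holds the vertices after the starting one, matching the form of `IsCycle`: an edge from
-- the end back to the start closes the path to a cycle.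
data Path (R : Rel (Fin n) 0ℓ) : Fin n → List (Fin n) → Fin n → Set where
  []  : Path R u [] u
  _∷_ : ∀ {vs} → R u w → Path R w vs v → Path R u (w ∷ vs) v

dropTo : ∀ {vs} → Path R u vs v → Unique (u ∷ vs) → w ∈ˡ u ∷ vs →
         ∃[ ws ] Path R w ws v × Unique (w ∷ ws)
dropTo path       unique       (here refl) = _ , path , unique
dropTo (_ ∷ path) (_ ∷ unique) (there w∈)  = dropTo path unique w∈

-- Loop erasure: if u recurs on the simple path built for the rest of the walk, keep only the part
-- from that occurrence on.
simplePath : Star R u v → ∃[ vs ] Path R u vs v × Unique (u ∷ vs)
simplePath ε = [] , [] , [] ∷ []
simplePath {u = u} (_◅_ {j = w} r walk) with simplePath walk
... | vs , path , unique with DecMembership._∈?_ _≟_ u (w ∷ vs)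
...   | yes u∈ = dropTo path unique u∈
...   | no  u∉ = w ∷ vs , r ∷ path , ¬Any⇒All¬ _ u∉ ∷ unique

linked : ∀ {vs} → R ⇒ S → Path R u vs v → S v x → Linked S (u ∷ vs ++ x ∷ [])
linked R⇒S []         vx = vx ∷ [-]
linked R⇒S (r ∷ path) vx = R⇒S r ∷ linked R⇒S path vx

-- No vertex of the walk is w, so none of its steps can be the edge wv.
walkAvoiding : ∀ {xs} → w ≢ v → All (w ≢_) (x ∷ xs) → Linked R (x ∷ xs ++ v ∷ []) →
               Star (Delete R w v) x v
walkAvoiding {xs = []} w≢v (w≢x ∷ _) (xv ∷ _) = (xv , ¬wv) ◅ ε
  where
  ¬wv : ¬ SameEdge _ _ _ _
  ¬wv (inj₁ (x≡w , _)) = w≢x (sym x≡w)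
  ¬wv (inj₂ (_ , v≡w)) = w≢v (sym v≡w)
walkAvoiding {xs = y ∷ _} w≢v (w≢x ∷ w≢xs@(w≢y ∷ _)) (xy ∷ ys) =
  (xy , ¬wv) ◅ walkAvoiding w≢v w≢xs ys
  where
  ¬wv : ¬ SameEdge _ _ _ _
  ¬wv (inj₁ (x≡w , _)) = w≢x (sym x≡w)
  ¬wv (inj₂ (_ , y≡w)) = w≢y (sym y≡w)

module _ (G : Graph n) where
  open Graph G

  acyclic⇒bridges : (∀ v vs → ¬ IsCycle v vs) → Adj u v → IsBridge Adj u v
  acyclic⇒bridges {u = u} acyclic uv walk with simplePath walk
  -- A path without steps would make uv a loop, and a path of one step would be the deleted edge
  -- itself. Any longer one is closed to a cycle by the edge vu.
  ... | []         , []            , _      = irreflexive uv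
  ... | _ ∷ []     , (_ , ¬uv) ∷ [] , _     = ¬uv (inj₁ (refl , refl))
  ... | w ∷ x ∷ vs , path          , unique =
    acyclic u (w ∷ x ∷ vs) (s≤s (s≤s z≤n) , unique , linked proj₁ path (symmetric uv))

  -- The rest of a cycle through the edge vw is a walk from w to v that avoids this edge.
  bridges⇒acyclic : (∀ {u v} → Adj u v → IsBridge Adj u v) → ∀ v vs → ¬ IsCycle v vs
  bridges⇒acyclic bridges v (w ∷ x ∷ vs)
    (_ , ((v≢w ∷ v≢x ∷ _) ∷ (w≢vs ∷ _)) , (vw ∷ wx ∷ rest)) =
    bridges (symmetric vw) ((wx , ¬wv) ◅ walkAvoiding (≢-sym v≢w) w≢vs rest)
    where
    ¬wv : ¬ SameEdge w v w x
    ¬wv (inj₁ (_ , x≡v)) = v≢x (sym x≡v)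
    ¬wv (inj₂ (w≡v , _)) = v≢w (sym w≡v)
  bridges⇒acyclic bridges v []       (() , _)
  bridges⇒acyclic bridges v (_ ∷ []) (s≤s () , _)

-- Graphs of decidable relations

does⁻ : ∀ {ℓ} {A : Set ℓ} (a? : Dec A) → does a? ≡ true → A
does⁻ (yes a) _ = a

module _ {R : Rel (Fin n) 0ℓ} (R? : Decidable R) where

  neighbours : Fin n → Subset n
  neighbours u = tabulate λ v → does (R? u v)

  ∈-neighbours⁺ : R u v → v ∈ neighbours u
  ∈-neighbours⁺ {u} {v} uv =
    lookup⇒[]= v _ (trans (lookup∘tabulate _ v) (dec-true (R? u v) uv))

  ∈-neighbours⁻ : v ∈ neighbours u → R u v
  ∈-neighbours⁻ {v} {u} v∈ =
    does⁻ (R? u v) (trans (sym (lookup∘tabulate _ v)) ([]=⇒lookup v∈))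

  graph : Symmetric R → (∀ {u} → ¬ R u u) → Graph n
  graph R-sym R-irrefl = record
    { nbrs        = neighbours
    ; symmetric   = ∈-neighbours⁺ ∘ R-sym ∘ ∈-neighbours⁻
    ; irreflexive = R-irrefl ∘ ∈-neighbours⁻
    }

open Graph using (Adj; nbrs; IsTree; Connected; symmetric; irreflexive)

IsBridge-map : S ⇒ R → IsBridge R u v → IsBridge S u v
IsBridge-map S⇒R bridge = bridge ∘ map (λ (uv , ¬s) → S⇒R uv , ¬s)

module _ (T : Graph n) where

  exchange? : (p q r : Fin n) → Decidable (Exchange (Adj T) p q r)
  exchange? p q r u v = (v ∈? nbrs T u ×-dec ¬? (sameEdge? p q u v)) ⊎-dec sameEdge? q r u v

  module _ (isTree : IsTree T) (pq : Adj T p q) (pr : Adj T p r) (q≢r : q ≢ r) where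

    exchange : Graph n
    exchange = graph (exchange? p q r)
      (Exchange-symmetric (symmetric T) (irreflexive T) pq pr q≢r)
      (Exchange-irreflexive (symmetric T) (irreflexive T) pq pr q≢r)

    exchange-isTree : IsTree exchange
    exchange-isTree = connected , bridges⇒acyclic exchange bridges
      where
      connected : Connected exchange
      connected u v = map (∈-neighbours⁺ (exchange? p q r))
        (Exchange-connected (symmetric T) (irreflexive T) pq pr q≢r (proj₁ isTree u v))
      bridges : Adj exchange u v → IsBridge (Adj exchange) u v
      bridges uv = IsBridge-map (∈-neighbours⁻ (exchange? p q r))
        (Exchange-isBridge (symmetric T) (irreflexive T) pq pr q≢r
          (acyclic⇒bridges T (proj₂ isTree)) (∈-neighbours⁻ (exchange? p q r) uv))

-- Counting

¬¬-∀Fin : ∀ {ℓ} {P : Fin n → Set ℓ} → (∀ i → ¬ ¬ P i) → ¬ ¬ (∀ i → P i)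
¬¬-∀Fin {n = ℕ.zero}  _   k = k λ ()
¬¬-∀Fin {n = ℕ.suc n} ¬¬P k = ¬¬P zero λ P₀ → ¬¬-∀Fin (¬¬P ∘ suc) λ P₊ →
  k λ { zero → P₀ ; (suc i) → P₊ i }

enumerate : (s : Subset n) → Fin ∣ s ∣ → Fin n
enumerate (inside  ∷ s) zero    = zero
enumerate (inside  ∷ s) (suc i) = suc (enumerate s i)
enumerate (outside ∷ s) i       = suc (enumerate s i)

enumerate-∈ : (s : Subset n) (i : Fin ∣ s ∣) → enumerate s i ∈ s
enumerate-∈ (inside  ∷ s) zero    = here
enumerate-∈ (inside  ∷ s) (suc i) = there (enumerate-∈ s i)
enumerate-∈ (outside ∷ s) i       = there (enumerate-∈ s i)

enumerate-injective : (s : Subset n) {i j : Fin ∣ s ∣} → enumerate s i ≡ enumerate s j → i ≡ j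
enumerate-injective (inside  ∷ s) {zero}  {zero}  eq = refl
enumerate-injective (inside  ∷ s) {suc i} {suc j} eq = cong suc (enumerate-injective s (suc-injective eq))
enumerate-injective (outside ∷ s)                 eq = enumerate-injective s (suc-injective eq)

module _ {a ℓ} {A : Set a} {P : Fin n → A → Set ℓ} where

  index-shared : ∀ {as} (i : Any (P u) as) (j : Any (P v) as) → index i ≡ index j →
                 ∃[ a ] P u a × P v a
  index-shared (here pu) (here pv) _  = _ , pu , pv
  index-shared (there i) (there j) eq = index-shared i j (suc-injective eq)

  -- Pigeonhole: sending each member of s to the position of a list entry covering it is injective,
  -- because no entry covers two members.
  ∣∣≤length : ∀ (s : Subset n) as → (∀ u → u ∈ s → Any (P u) as) →
              (∀ {u v a} → u ∈ s → v ∈ s → P u a → P v a → u ≡ v) → ∣ s ∣ ℕ.≤ length as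
  ∣∣≤length s as covered packed = injective⇒≤ {f = f} f-injective
    where
    f : Fin ∣ s ∣ → Fin (length as)
    f i = index (covered (enumerate s i) (enumerate-∈ s i))
    f-injective : ∀ {i j} → f i ≡ f j → i ≡ j
    f-injective {i} {j} eq with index-shared (covered _ (enumerate-∈ s i)) (covered _ (enumerate-∈ s j)) eq
    ... | _ , pi , pj = enumerate-injective s (packed (enumerate-∈ s i) (enumerate-∈ s j) pi pj)

-- Weights and coverings

module _ {c ℓ₁ ℓ₂} (ℝ : RealNumbers c ℓ₁ ℓ₂) where
  open RealNumbers ℝ
  open OrderedField ℝ
  open ≤-Reasoning
  open Sum +-commutativeMonoid using (sum-cong-≋; ∑-distrib-+; sum-replicate-zero)

  infix 7 _when_
  -- Indicator notation with the same body as the summand of `weight`, so that `weight` is a double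
  -- sum of such terms by definition.
  _when_ : ∀ {ℓ} {A : Set ℓ} → Carrier → Dec A → Carrier
  x when a? = if does a? then x else 0#

  when-true : ∀ {ℓ} {A : Set ℓ} {x} (a? : Dec A) → A → x when a? ≈ x
  when-true (yes _) _ = ≈-refl
  when-true (no ¬a) a = contradiction a ¬a

  when-false : ∀ {ℓ} {A : Set ℓ} {x} (a? : Dec A) → ¬ A → x when a? ≈ 0#
  when-false (yes a) ¬a = contradiction a ¬a
  when-false (no _)  _  = ≈-refl

  when-⊎ : ∀ {ℓ ℓ′ ℓ″} {A : Set ℓ} {B : Set ℓ′} {C : Set ℓ″} {x}
           (a? : Dec A) (b? : Dec B) (c? : Dec C) →
           (A → B ⊎ C) → (B ⊎ C → A) → ¬ (B × C) → x when a? ≈ x when b? + x when c?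
  when-⊎ {x = x} a? (yes b) c? to from disjoint = ≈-trans (when-true a? (from (inj₁ b)))
    (≈-sym (≈-trans (+-congˡ (when-false c? λ c → disjoint (b , c))) (+-identityʳ x)))
  when-⊎ {x = x} a? (no ¬b) (yes c) to from disjoint =
    ≈-trans (when-true a? (from (inj₂ c))) (≈-sym (+-identityˡ x))
  when-⊎ a? (no ¬b) (no ¬c) to from disjoint =
    ≈-trans (when-false a? ([ ¬b , ¬c ] ∘ to)) (≈-sym (+-identityˡ 0#))

  sum-zero : ∀ {n} {f : Fin n → Carrier} → (∀ i → f i ≈ 0#) → sum f ≈ 0#
  sum-zero {n} f≈0 = ≈-trans (sum-cong-≋ f≈0) (sum-replicate-zero n)

  sum-single : ∀ {n} {f : Fin n → Carrier} i → (∀ j → j ≢ i → f j ≈ 0#) → sum f ≈ f i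
  sum-single zero    f≈0 = ≈-trans (+-congˡ (sum-zero λ j → f≈0 (suc j) λ ())) (+-identityʳ _)
  sum-single (suc i) f≈0 = ≈-trans
    (+-cong (f≈0 zero λ ()) (sum-single i λ j j≢i → f≈0 (suc j) (j≢i ∘ suc-injective)))
    (+-identityˡ _)

  -- Powers of two and logarithms

  pow2-suc : ∀ k x → fromℕ 2 ^ ℕ.suc k * x ≈ fromℕ 2 ^ k * x + fromℕ 2 ^ k * x
  pow2-suc k x = begin-equality
    fromℕ 2 * fromℕ 2 ^ k * x           ≈⟨ *-assoc (fromℕ 2) (fromℕ 2 ^ k) x ⟩
    fromℕ 2 * (fromℕ 2 ^ k * x)         ≈⟨ fromℕ*≈· 2 _ ⟩
    2 · (fromℕ 2 ^ k * x)               ≈⟨ 2·x≈x+x _ ⟩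
    fromℕ 2 ^ k * x + fromℕ 2 ^ k * x   ∎

  -- This is the comparison with the integer exponent (a - 0) / 1.
  ≈2^-upper : ∀ {y t} a → y ≈2^ t → t ≤ fromℕ a → y ≤ fromℕ 2 ^ a
  ≈2^-upper {y} {t} a y≈2^t t≤a = begin
    y               ≈⟨ *-identityʳ y ⟨
    y ^ 1           ≈⟨ *-identityˡ (y ^ 1) ⟨
    fromℕ 2 ^ 0 * y ^ 1 ≤⟨ _≈2^_.upper y≈2^t a 0 1 (begin
      fromℕ 0 + fromℕ 1 * t ≈⟨ +-identityˡ _ ⟩
      fromℕ 1 * t           ≈⟨ fromℕ*≈· 1 t ⟩
      1 · t                 ≈⟨ +-identityʳ t ⟩
      t                     ≤⟨ t≤a ⟩
      fromℕ a               ∎) ⟩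
    fromℕ 2 ^ a     ∎

  ≈2^-lower : ∀ {y t} a → y ≈2^ t → fromℕ a ≤ t → fromℕ 2 ^ a ≤ y
  ≈2^-lower {y} {t} a y≈2^t a≤t = begin
    fromℕ 2 ^ a     ≤⟨ _≈2^_.lower y≈2^t a 0 1 (begin
      fromℕ a               ≤⟨ a≤t ⟩
      t                     ≈⟨ +-identityʳ t ⟨
      1 · t                 ≈⟨ fromℕ*≈· 1 t ⟨
      fromℕ 1 * t           ≈⟨ +-identityˡ _ ⟨
      fromℕ 0 + fromℕ 1 * t ∎) ⟩
    fromℕ 2 ^ 0 * y ^ 1 ≈⟨ *-identityˡ (y ^ 1) ⟩
    y ^ 1           ≈⟨ *-identityʳ y ⟩
    y               ∎

  -- If t were below 1/2, comparing with the exponent 1/2 would give y² ≤ 2, whereas 2 ≤ y gives 4 ≤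
  -- y².
  2≤⇒1≤2·log : ∀ {y t} → y ≈2^ t → fromℕ 2 ≤ y → 1# ≤ 2 · t
  2≤⇒1≤2·log {y} {t} y≈2^t 2≤y 2t<1 = 4≤2 (fromℕ-mono-< {2} {4} (s≤s (s≤s (s≤s z≤n))))
    where
    4≤2 : fromℕ 4 ≤ fromℕ 2
    4≤2 = begin
      fromℕ 4             ≈⟨ ×1-homo-* 2 2 ⟩
      fromℕ 2 * fromℕ 2   ≤⟨ *-monoʳ-≤ (0≤fromℕ 2) 2≤y ⟩
      fromℕ 2 * y         ≤⟨ *-monoˡ-≤ (≤-trans (0≤fromℕ 2) 2≤y) 2≤y ⟩
      y * y               ≈⟨ *-congˡ (*-identityʳ y) ⟨
      y ^ 2               ≈⟨ *-identityˡ (y ^ 2) ⟨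
      fromℕ 2 ^ 0 * y ^ 2 ≤⟨ _≈2^_.upper y≈2^t 1 0 2 (begin
        fromℕ 0 + fromℕ 2 * t ≈⟨ +-identityˡ _ ⟩
        fromℕ 2 * t           ≈⟨ fromℕ*≈· 2 t ⟩
        2 · t                 ≤⟨ <⇒≤ 2t<1 ⟩
        1#                    ≈⟨ +-identityʳ 1# ⟨
        fromℕ 1               ∎) ⟩
      fromℕ 2 ^ 1         ≈⟨ *-identityʳ (fromℕ 2) ⟩
      fromℕ 2             ∎

  -- Metric weights of trees

  module _ {n} (X : FiniteMetricSpace ℝ n) where
    open FiniteMetricSpace X
    private module M = IsGeneralMetric isMetric

    d-pos : ∀ {x y} → x ≢ y → ¬ d x y ≤ 0#
    d-pos x≢y d≤0 = x≢y (M.0⇒≈ (≤-antisym d≤0 M.nonNegative))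

    weight-edge : ∀ {a b} → a Fin.< b →
                  (sum λ u → sum λ v → d u v when (u ≟ a ×-dec v ≟ b)) ≈ d a b
    weight-edge {a} {b} a<b = ≈-trans
      (sum-single a λ u u≢a → sum-zero λ v → when-false (u ≟ a ×-dec v ≟ b) (u≢a ∘ proj₁))
      (≈-trans
        (sum-single b λ v v≢b → when-false (a ≟ a ×-dec v ≟ b) (v≢b ∘ proj₂))
        (when-true (a ≟ a ×-dec b ≟ b) (refl , refl)))

    private
      weight-Insert-< : ∀ (G H : Graph n) {a b} → a Fin.< b → ¬ Adj H a b →
                        (∀ {u v} → Adj G u v → Insert (Adj H) a b u v) →
                        (∀ {u v} → Insert (Adj H) a b u v → Adj G u v) →
                        weight G ≈ weight H + d a b
      weight-Insert-< G H {a} {b} a<b ¬ab to from = begin-equality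
        weight G
          ≈⟨ sum-cong-≋ (λ u → ≈-trans (sum-cong-≋ (pointwise u)) (∑-distrib-+ (old u) (new u))) ⟩
        (sum λ u → sum (old u) + sum (new u))
          ≈⟨ ∑-distrib-+ (λ u → sum (old u)) (λ u → sum (new u)) ⟩
        weight H + (sum λ u → sum (new u))
          ≈⟨ +-congˡ (weight-edge a<b) ⟩
        weight H + d a b ∎
        where
        old new : Fin n → Fin n → Carrier
        old u v = d u v when (u <? v ×-dec v ∈? nbrs H u)
        new u v = d u v when (u ≟ a ×-dec v ≟ b)
        pointwise : ∀ u v → d u v when (u <? v ×-dec v ∈? nbrs G u) ≈ old u v + new u v
        pointwise u v = when-⊎ (u <? v ×-dec v ∈? nbrs G u) (u <? v ×-dec v ∈? nbrs H u)
          (u ≟ a ×-dec v ≟ b)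
          (λ (u<v , uv) → case to uv of λ where
            (inj₁ uv)                       → inj₁ (u<v , uv)
            (inj₂ (inj₁ same))              → inj₂ same
            -- `weight` counts an edge once, from its smaller end, so the reversed copy of ab cannot
            -- occur.
            (inj₂ (inj₂ (refl , refl))) → contradiction a<b (Fin.<-asym u<v))
          (λ where
            (inj₁ (u<v , uv))         → u<v , from (inj₁ uv)
            (inj₂ (refl , refl)) → a<b , from (inj₂ (inj₁ (refl , refl))))
          (λ { ((_ , uv) , (refl , refl)) → ¬ab uv })

    weight-Insert : ∀ (G H : Graph n) {a b} → a ≢ b → ¬ Adj H a b →
                    (∀ {u v} → Adj G u v → Insert (Adj H) a b u v) →
                    (∀ {u v} → Insert (Adj H) a b u v → Adj G u v) →
                    weight G ≈ weight H + d a b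
    weight-Insert G H {a} {b} a≢b ¬ab to from with <-cmp a b
    ... | tri< a<b _ _ = weight-Insert-< G H a<b ¬ab to from
    ... | tri≈ _ a≡b _ = contradiction a≡b a≢b
    ... | tri> _ _ b<a = ≈-trans
      (weight-Insert-< G H b<a (¬ab ∘ symmetric H) (swap ∘ to) (from ∘ swap))
      (+-congˡ (M.sym b a))
      where
      swap : ∀ {a b u v} → Insert (Adj H) a b u v → Insert (Adj H) b a u v
      swap (inj₁ uv)          = inj₁ uv
      swap (inj₂ (inj₁ same)) = inj₂ (inj₂ same)
      swap (inj₂ (inj₂ same)) = inj₂ (inj₁ same)

    module _ (T : Graph n) (isMST : IsMinimumSpanningTree T) where

      -- Both T and the exchanged tree T′ are the forest T₀ = T - pq with one edge added, so their
      -- weights differ exactly as d(p,q) and d(q,r) do.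
      siblings-separated : ∀ {p q r} → Adj T p q → Adj T p r → q ≢ r → d p q ≤ d q r
      siblings-separated {p} {q} {r} pq pr q≢r qr<pq =
        proj₂ isMST T′ (exchange-isTree T (proj₁ isMST) pq pr q≢r)
          (<-respˡ-≈ (≈-sym weight-T′) (<-respʳ-≈ (≈-sym weight-T) (+-monoʳ-< (weight T₀) qr<pq)))
        where
        T′ : Graph n
        T′ = exchange T (proj₁ isMST) pq pr q≢r
        T₀? : Decidable (Delete (Adj T) p q)
        T₀? u v = v ∈? nbrs T u ×-dec ¬? (sameEdge? p q u v)
        T₀ : Graph n
        T₀ = graph T₀? (Delete-symmetric {R = Adj T} (symmetric T)) (Graph.irreflexive T ∘ proj₁)
        p≢q : p ≢ q
        p≢q refl = Graph.irreflexive T pq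
        -- Otherwise p, r, q would be a walk in T avoiding the bridge pq.
        ¬qr : ¬ Adj T₀ q r
        ¬qr qr = acyclic⇒bridges T (proj₂ (proj₁ isMST)) pq
          ((pr , ¬pq-pr) ◅ Delete-symmetric {R = Adj T} (symmetric T) (∈-neighbours⁻ T₀? qr) ◅ ε)
          where
          ¬pq-pr : ¬ SameEdge p q p r
          ¬pq-pr (inj₁ (_ , refl)) = q≢r refl
          ¬pq-pr (inj₂ (p≡q , _))    = p≢q p≡q
        weight-T : weight T ≈ weight T₀ + d p q
        weight-T = weight-Insert T T₀ p≢q
          (λ pq → proj₂ (∈-neighbours⁻ T₀? pq) (inj₁ (refl , refl))) to from
          where
          to : ∀ {u v} → Adj T u v → Insert (Adj T₀) p q u v
          to {u} {v} uv with sameEdge? p q u v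
          ... | yes same = inj₂ same
          ... | no ¬same = inj₁ (∈-neighbours⁺ T₀? (uv , ¬same))
          from : ∀ {u v} → Insert (Adj T₀) p q u v → Adj T u v
          from (inj₁ uv)                   = proj₁ (∈-neighbours⁻ T₀? uv)
          from (inj₂ (inj₁ (refl , refl))) = pq
          from (inj₂ (inj₂ (refl , refl))) = symmetric T pq
        weight-T′ : weight T′ ≈ weight T₀ + d q r
        weight-T′ = weight-Insert T′ T₀ q≢r ¬qr
          (map₁ (∈-neighbours⁺ T₀?) ∘ ∈-neighbours⁻ (exchange? T p q r))
          (∈-neighbours⁺ (exchange? T p q r) ∘ map₁ (∈-neighbours⁻ T₀?))

    -- Coverings

    Cover : Fin n → Carrier → Carrier → ℕ → Set ℓ₂
    Cover x r s k = Σ[ zs ∈ List (Fin n) ] length zs ℕ.≤ k ×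
      (∀ y → d x y ≤ r → Any (λ z → d z y ≤ s) zs)

    Cover-trans : ∀ {x r s t k l} → Cover x r s k → (∀ z → Cover z s t l) → Cover x r t (k ℕ.* l)
    Cover-trans {l = l} (zs , ∣zs∣≤k , zs-cover) cover =
      concatMap (proj₁ ∘ cover) zs ,
      ℕ.≤-trans (length-concatMap zs) (ℕ.*-monoˡ-≤ l ∣zs∣≤k) ,
      λ y xy≤r → Any.concatMap⁺ (proj₁ ∘ cover)
        (Any.map (λ {z} → proj₂ (proj₂ (cover z)) y) (zs-cover y xy≤r))
      where
      length-concatMap : ∀ zs → length (concatMap (proj₁ ∘ cover) zs) ℕ.≤ length zs ℕ.* l
      length-concatMap []       = z≤n
      length-concatMap (z ∷ zs) = subst (ℕ._≤ l ℕ.+ length zs ℕ.* l)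
        (sym (length-++ (proj₁ (cover z))))
        (ℕ.+-mono-≤ (proj₁ (proj₂ (cover z))) (length-concatMap zs))

    -- Dyadic annuli about a vertex

    module Annuli {K : ℕ} (double-cover : ∀ x s → Cover x (s + s) s K) where

      K³ : ℕ
      K³ = K ℕ.* K ℕ.* K

      Cover-half : ∀ {r s} → r ≈ s + s → ∀ x → Cover x r s K
      Cover-half {r} {s} r≈s+s x =
        let zs , ∣zs∣≤K , zs-cover = double-cover x s
        in  zs , ∣zs∣≤K , λ y xy≤r → zs-cover y (≤-trans xy≤r (≤-reflexive r≈s+s))

      -- (z , s) stands for the ball of radius s about z.
      Captures : Fin n → Fin n → Fin n × Carrier → Set ℓ₂
      Captures p q (z , s) = d z q ≤ s × (s + s) + (s + s) ≤ d p q

      -- The balls are given outright and only the coverage is doubly negated: gluing two annuli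
      -- requires deciding on which side of the common radius a point lies.
      Shell : Fin n → Carrier → Carrier → ℕ → Set (c ⊔ ℓ₂)
      Shell p r R k = Σ[ bs ∈ List (Fin n × Carrier) ] length bs ℕ.≤ k ×
        (∀ q → r ≤ d p q → d p q ≤ R → ¬ ¬ Any (Captures p q) bs)

      annulus : ∀ p r → Shell p r (r + r) K³
      annulus p r =
        List.map (_, s) zs , subst (ℕ._≤ K³) (sym (length-map (_, s) zs)) ∣zs∣≤K³ ,
        λ q r≤pq pq≤2r k → k (Any.map⁺ (Any.map (_, far r≤pq) (zs-cover q pq≤2r)))
        where
        -- Here s = r/4: the radii run through 2r, r, r/2, s, and the condition 4s ≤ d(p,q) in
        -- `Captures` amounts to r ≤ d(p,q).
        r₂ = proj₁ (halving r)
        r≈2r₂ = proj₂ (halving r)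
        s = proj₁ (halving r₂)
        r₂≈2s = proj₂ (halving r₂)
        cover : Cover p (r + r) s K³
        cover = Cover-trans (Cover-trans (double-cover p r) (Cover-half r≈2r₂)) (Cover-half r₂≈2s)
        zs = proj₁ cover
        ∣zs∣≤K³ = proj₁ (proj₂ cover)
        zs-cover = proj₂ (proj₂ cover)
        far : ∀ {q} → r ≤ d p q → (s + s) + (s + s) ≤ d p q
        far r≤pq = ≤-trans (≤-reflexive (≈-sym (≈-trans r≈2r₂ (+-cong r₂≈2s r₂≈2s)))) r≤pq

      Shell-++ : ∀ {p r R S k l} → Shell p R S k → Shell p r R l → Shell p r S (k ℕ.+ l)
      Shell-++ {p} {R = R} {k = k} {l} (bs , ∣bs∣≤k , outer) (bs′ , ∣bs′∣≤l , inner) =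
        bs ++ bs′ ,
        subst (ℕ._≤ k ℕ.+ l) (sym (length-++ bs)) (ℕ.+-mono-≤ ∣bs∣≤k ∣bs′∣≤l) ,
        λ q r≤pq pq≤S k → ≤-dichotomy (d p q) R λ where
          (inj₁ pq≤R) → inner q r≤pq pq≤R (k ∘ Any.++⁺ʳ bs)
          (inj₂ R<pq) → outer q (<⇒≤ R<pq) pq≤S (k ∘ Any.++⁺ˡ)

      Shell-respʳ-≈ : ∀ {p r R S k} → R ≈ S → Shell p r R k → Shell p r S k
      Shell-respʳ-≈ R≈S (bs , ∣bs∣≤k , cover) =
        bs , ∣bs∣≤k , λ q r≤pq pq≤S → cover q r≤pq (≤-trans pq≤S (≤-reflexive (≈-sym R≈S)))

      -- The annuli between 2^i m and 2^(i+1) m for i = 0, ..., L are glued together. There are L +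
      -- 1 of them, so `L` equal to 0 already gives one.
      annuli : ∀ p m L → Shell p m (fromℕ 2 ^ ℕ.suc L * m) (ℕ.suc L ℕ.* K³)
      annuli p m ℕ.zero = subst (Shell p m _) (sym (ℕ.+-identityʳ K³))
        (Shell-respʳ-≈ (≈-sym (≈-trans (pow2-suc 0 m) (+-cong (*-identityˡ m) (*-identityˡ m))))
          (annulus p m))
      annuli p m (ℕ.suc L) =
        Shell-++ (Shell-respʳ-≈ (≈-sym (pow2-suc (ℕ.suc L) m)) (annulus p (fromℕ 2 ^ ℕ.suc L * m)))
          (annuli p m L)

      module _ (T : Graph n) (isMST : IsMinimumSpanningTree T) (p : Fin n) where

        -- Distinct neighbours in one ball would satisfy 4s ≤ d(p,q) ≤ d(q,r) ≤ 2s, hence 2s ≤ 0 and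
        -- d(q,r) ≤ 0.
        Captures-packed : ∀ {q r b} → Adj T p q → Adj T p r → Captures p q b → Captures p r b → q ≡ r
        Captures-packed {q} {r} {z , s} pq pr (zq≤s , 4s≤pq) (zr≤s , _) = decidable-stable (q ≟ r) λ q≢r →
          let qr≤2s = begin
                d q r         ≤⟨ M.triangle q z r ⟩
                d q z + d z r ≈⟨ +-congʳ (M.sym q z) ⟩
                d z q + d z r ≤⟨ +-mono-≤ zq≤s zr≤s ⟩
                s + s         ∎
              4s≤2s = begin
                (s + s) + (s + s) ≤⟨ 4s≤pq ⟩
                d p q             ≤⟨ siblings-separated T isMST pq pr q≢r ⟩
                d q r             ≤⟨ qr≤2s ⟩
                s + s             ∎
          in d-pos q≢r (≤-trans qr≤2s (x+x≤x⇒x≤0 4s≤2s))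

        degree-bound : ∀ m L → (∀ q → q ≢ p → m ≤ d p q) →
                       (∀ q → q ≢ p → d p q ≤ fromℕ 2 ^ ℕ.suc L * m) →
                       ¬ ¬ Graph.degree T p ℕ.≤ ℕ.suc L ℕ.* K³
        -- The ball list is fixed first; `¬¬-∀Fin` then gathers the doubly negated coverage of all
        -- vertices before counting.
        degree-bound m L m≤ ≤2^Lm k = let bs , ∣bs∣≤ , _ = annuli p m L in ¬¬-∀Fin covered λ cover →
          k (ℕ.≤-trans (∣∣≤length (nbrs T p) bs cover Captures-packed) ∣bs∣≤)
          where
          covered : ∀ q → ¬ ¬ (Adj T p q → Any (Captures p q) (proj₁ (annuli p m L)))
          covered q k with q ∈? nbrs T p
          ... | no ¬pq = k λ pq → contradiction pq ¬pq
          ... | yes pq = proj₂ (proj₂ (annuli p m L)) q (m≤ q q≢p) (≤2^Lm q q≢p) λ any → k λ _ → any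
            where
            q≢p : q ≢ p
            q≢p refl = Graph.irreflexive T pq

    -- Suppose one ball of radius s = m/2 about z contains both p and its nearest point q. If z is
    -- p, then m = d(p,q) ≤ s; otherwise m ≤ d(p,z) ≤ s. Either way m ≤ 0, contradicting the
    -- distinctness of p and q.
    2≤∣half-cover∣ : ∀ {p m s N} → IsMinDistance p m → m ≈ s + s → Cover p (s + s) s N → 2 ℕ.≤ N
    2≤∣half-cover∣ {p} {m} {s} (m≤ , q , q≢p , pq≈m) m≈2s (zs , ∣zs∣≤N , cover) =
      ℕ.≤-trans (2≤∣zs∣ zs p-covered q-covered) ∣zs∣≤N
      where
      ¬m≤s : ¬ m ≤ s
      ¬m≤s m≤s = d-pos (q≢p ∘ sym) (begin
        d p q ≈⟨ pq≈m ⟩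
        m     ≤⟨ m≤s ⟩
        s     ≤⟨ x+x≤x⇒x≤0 (≤-trans (≤-reflexive (≈-sym m≈2s)) m≤s) ⟩
        0#    ∎)
      q-covered : Any (λ z → d z q ≤ s) zs
      q-covered = cover q (≤-reflexive (≈-trans pq≈m m≈2s))
      p-covered : Any (λ z → d z p ≤ s) zs
      p-covered = cover p (begin
        d p p ≈⟨ M.≈⇒0 refl ⟩
        0#    ≤⟨ M.nonNegative ⟩
        d p q ≈⟨ ≈-trans pq≈m m≈2s ⟩
        s + s ∎)
      2≤∣zs∣ : ∀ zs → Any (λ z → d z p ≤ s) zs → Any (λ z → d z q ≤ s) zs → 2 ℕ.≤ length zs
      2≤∣zs∣ (_ ∷ _ ∷ _) _ _ = s≤s (s≤s z≤n)
      2≤∣zs∣ (z ∷ []) (here zp≤s) (here zq≤s) with z ≟ p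
      ... | yes refl = contradiction (≤-trans (≤-reflexive (≈-sym pq≈m)) zq≤s) ¬m≤s
      ... | no z≢p     = contradiction
        (≤-trans (m≤ z z≢p) (≤-trans (≤-reflexive (M.sym p z)) zp≤s)) ¬m≤s

    -- The degree bound

    degree≤ : ∀ {ddim} → IsDoublingDimension ddim →
              ∀ (T : Graph n) → IsMinimumSpanningTree T →
              ∀ p Δ → IsAspectRatio p Δ → ∀ logΔ → IsLog₂ Δ logΔ →
              ∀ E → E ≈2^ (fromℕ 11 * ddim) → fromℕ (Graph.degree T p) ≤ E * max 1# logΔ
    degree≤ {t} (0≤t , (N , N≈2^t , cover) , _) T isMST p Δ
            (M , m , (≤M , _) , isMin , Δm≈M) logΔ Δ≈2^logΔ E E≈2^11t E*mx<deg =
      -- With the reverse strict inequality assumed the goal is empty, so both ceilings may be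
      -- taken: A rounds up ddim, giving K = 2^A, and the second rounds up `mx`, giving the number
      -- of annuli.
      ceiling 0≤t λ (A , t≤A , A≤1+t) → ceiling 0≤mx λ where
        (ℕ.zero  , mx≤0 , _)      → ≤-trans 1≤mx mx≤0 0<1
        (ℕ.suc L , mx≤L , L≤1+mx) →
          Annuli.degree-bound (double-cover A t≤A) T isMST p m L (proj₁ isMin) (pq≤2^L*m L mx≤L) λ deg≤ →
            ≤-trans (fromℕ-mono-≤ deg≤) (L*K³≤E*mx A A≤1+t (ℕ.suc L) L≤1+mx) E*mx<deg
      where
      -- The lower bound 1 guarantees at least one annulus and makes rounding up cost at most a
      -- factor 2, even when all distances from p are equal.
      mx = max 1# logΔ
      1≤mx : 1# ≤ mx
      1≤mx = proj₁ (max-supremum 1# logΔ)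
      0≤mx : 0# ≤ mx
      0≤mx = ≤-trans (<⇒≤ 0<1) 1≤mx
      logΔ≤mx : logΔ ≤ mx
      logΔ≤mx = proj₁ (proj₂ (max-supremum 1# logΔ))
      0≤m : 0# ≤ m
      0≤m = let _ , q , _ , pq≈m = isMin in ≤-trans M.nonNegative (≤-reflexive pq≈m)
      1≤2t : 1# ≤ 2 · t
      1≤2t = let s , m≈2s = halving m ; zs , ∣zs∣≤N , zs-cover = cover p s in
        2≤⇒1≤2·log N≈2^t
          (≤-trans (fromℕ-mono-≤ (2≤∣half-cover∣ isMin m≈2s (zs , ℕ.≤-refl , zs-cover))) ∣zs∣≤N)

      double-cover : ∀ A → t ≤ fromℕ A → ∀ x s → Cover x (s + s) s (2 ℕ.^ A)
      double-cover A t≤A x s = let zs , ∣zs∣≤N , zs-cover = cover x s in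
        zs , fromℕ-cancel-≤ (begin
          fromℕ (length zs) ≤⟨ ∣zs∣≤N ⟩
          N                 ≤⟨ ≈2^-upper A N≈2^t t≤A ⟩
          fromℕ 2 ^ A       ≈⟨ fromℕ-^ 2 A ⟨
          fromℕ (2 ℕ.^ A)   ∎) , zs-cover

      pq≤2^L*m : ∀ L → mx ≤ fromℕ (ℕ.suc L) → ∀ q → q ≢ p → d p q ≤ fromℕ 2 ^ ℕ.suc L * m
      pq≤2^L*m L mx≤L q q≢p = begin
        d p q                 ≤⟨ ≤M q q≢p ⟩
        M                     ≈⟨ Δm≈M ⟨
        Δ * m                 ≤⟨ *-monoˡ-≤ 0≤m (≈2^-upper (ℕ.suc L) Δ≈2^logΔ (≤-trans logΔ≤mx mx≤L)) ⟩
        fromℕ 2 ^ ℕ.suc L * m ∎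

      -- The origin of the constant 11: rounding gives A ≤ 1 + t ≤ 3t because 1 ≤ 2t, so 1 + 3A ≤ 2t
      -- + 9t. The term 3A is the exponent of K³, and the 1 that of the factor 2 lost in rounding
      -- `mx`.
      A≤3t⇒1+3A≤11t : ∀ A → fromℕ A ≤ 3 · t → fromℕ (1 ℕ.+ (A ℕ.+ A ℕ.+ A)) ≤ fromℕ 11 * t
      A≤3t⇒1+3A≤11t A A≤3t = begin
        1# + fromℕ (A ℕ.+ A ℕ.+ A)
          ≈⟨ +-congˡ (≈-trans (×-homo-+ 1# (A ℕ.+ A) A) (+-congʳ (×-homo-+ 1# A A))) ⟩
        1# + (fromℕ A + fromℕ A + fromℕ A)
          ≤⟨ +-mono-≤ 1≤2t (+-mono-≤ (+-mono-≤ A≤3t A≤3t) A≤3t) ⟩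
        2 · t + (3 · t + 3 · t + 3 · t)
          ≈⟨ +-congˡ (≈-trans (×-homo-+ t 6 3) (+-congʳ (×-homo-+ t 3 3))) ⟨
        2 · t + 9 · t ≈⟨ ×-homo-+ t 2 9 ⟨
        11 · t        ≈⟨ fromℕ*≈· 11 t ⟨
        fromℕ 11 * t  ∎

      2K³≡2^ : ∀ A → 2 ℕ.* (2 ℕ.^ A ℕ.* 2 ℕ.^ A ℕ.* 2 ℕ.^ A) ≡ 2 ℕ.^ (1 ℕ.+ (A ℕ.+ A ℕ.+ A))
      2K³≡2^ A = cong (2 ℕ.*_) (sym (trans (ℕ.^-distribˡ-+-* 2 (A ℕ.+ A) A)
        (cong (ℕ._* 2 ℕ.^ A) (ℕ.^-distribˡ-+-* 2 A A))))

      2K³≤E : ∀ A → fromℕ A ≤ 1# + t → fromℕ (2 ℕ.* (2 ℕ.^ A ℕ.* 2 ℕ.^ A ℕ.* 2 ℕ.^ A)) ≤ E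
      2K³≤E A A≤1+t = begin
        fromℕ (2 ℕ.* (2 ℕ.^ A ℕ.* 2 ℕ.^ A ℕ.* 2 ℕ.^ A)) ≡⟨ cong fromℕ (2K³≡2^ A) ⟩
        fromℕ (2 ℕ.^ 1+3A) ≈⟨ fromℕ-^ 2 1+3A ⟩
        fromℕ 2 ^ 1+3A     ≤⟨ ≈2^-lower 1+3A E≈2^11t (A≤3t⇒1+3A≤11t A A≤3t) ⟩
        E                  ∎
        where
        1+3A = 1 ℕ.+ (A ℕ.+ A ℕ.+ A)
        A≤3t : fromℕ A ≤ 3 · t
        A≤3t = begin
          fromℕ A   ≤⟨ A≤1+t ⟩
          1# + t    ≤⟨ +-monoˡ-≤ t 1≤2t ⟩
          2 · t + t ≈⟨ +-comm (2 · t) t ⟩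
          3 · t     ∎

      -- Since 1 ≤ `mx`, L ≤ 1 + mx ≤ 2 mx; the factor 2 moves over to K³, and E absorbs both.
      L*K³≤E*mx : ∀ A → fromℕ A ≤ 1# + t → ∀ L → fromℕ L ≤ 1# + mx →
                  fromℕ (L ℕ.* (2 ℕ.^ A ℕ.* 2 ℕ.^ A ℕ.* 2 ℕ.^ A)) ≤ E * mx
      L*K³≤E*mx A A≤1+t L L≤1+mx = begin
        fromℕ (L ℕ.* K³)          ≈⟨ ×1-homo-* L K³ ⟩
        fromℕ L * fromℕ K³        ≤⟨ *-monoˡ-≤ (0≤fromℕ K³) (≤-trans L≤1+mx (+-monoˡ-≤ mx 1≤mx)) ⟩
        (mx + mx) * fromℕ K³      ≈⟨ *-congʳ (≈-trans (fromℕ*≈· 2 mx) (2·x≈x+x mx)) ⟨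
        fromℕ 2 * mx * fromℕ K³   ≈⟨ *-congʳ (*-comm (fromℕ 2) mx) ⟩
        mx * fromℕ 2 * fromℕ K³   ≈⟨ *-assoc mx (fromℕ 2) (fromℕ K³) ⟩
        mx * (fromℕ 2 * fromℕ K³) ≈⟨ *-congˡ (×1-homo-* 2 K³) ⟨
        mx * fromℕ (2 ℕ.* K³)     ≤⟨ *-monoʳ-≤ 0≤mx (2K³≤E A A≤1+t) ⟩
        mx * E                    ≈⟨ *-comm mx E ⟩
        E * mx                    ∎
        where
        K³ = 2 ℕ.^ A ℕ.* 2 ℕ.^ A ℕ.* 2 ℕ.^ A

propositionA1 : ∀ {c ℓ₁ ℓ₂} →
    Σ[ C ∈ ℕ ]
    ((ℝ : RealNumbers c ℓ₁ ℓ₂) → let open RealNumbers ℝ in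
    ∀ (n : ℕ) → 2 ℕ.≤ n →
    (X : FiniteMetricSpace ℝ n) → let open FiniteMetricSpace X in
    ∀ (ddim : Carrier) → IsDoublingDimension ddim →
    ∀ (T : Graph n) → IsMinimumSpanningTree T →
    ∀ (p : Fin n) (Δ : Carrier) → IsAspectRatio p Δ →
    ∀ (logΔ : Carrier) → IsLog₂ Δ logΔ →
    ∀ (E : Carrier) → E ≈2^ (fromℕ C * ddim) →
    fromℕ (Graph.degree T p) ≤ E * max 1# logΔ)
propositionA1 = 11 , λ ℝ n _ X _ isDim T isMST p Δ isRatio logΔ isLog E E≈ →
  degree≤ ℝ X isDim T isMST p Δ isRatio logΔ isLog E E≈
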